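{- For any graph $G$ we have $$\frac{\operatorname{mad}(G)}{4} \leq \operatorname{qn}_\ell(G) \leq \frac{\operatorname{mad}(G)}{2}+2,$$ where $\operatorname{mad}(G)$ is the maximum average degree of $G$ and $\operatorname{qn}_\ell(G)$ is the local queue number of $G$.
   Context: Graphs are finite, simple, undirected and nonempty. The maximum average degree is $\operatorname{mad}(G)=\max\{2|E(H)|/|V(H)| : H\subseteq G,\ H\neq\emptyset\}$, the maximum being over subgraphs $H$ with at least one vertex. Given a linear ordering $\prec$ of the vertex set of a graph, two edges $uv$ and $xy$ nest if $u \prec x \prec y \prec v$ or $x \prec u \prec v \prec y$ (for the endpoints named suitably). A queue is a set of edges no two of which nest. A queue layout of $G$ consists of a linear ordering $\prec$ of $V(G)$ and a partition of $E(G)$ into queues; it is $\ell$-local if every vertex has incident edges in at most $\ell$ queues (the total number of queues being arbitrary). The local queue number $\operatorname{qn}_\ell(G)$ (the subscript is part of the name, not a parameter) is the smallest integer $\ell$ such that $G$ has an $\ell$-local queue layout. -}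

module Defs where

open import Data.Bool.Base using (Bool; true; false; T)
open import Data.Empty using (⊥-elim)
open import Data.Fin.Base using (Fin; zero; suc; combine; remQuot; fromℕ<)
  renaming (_<_ to _<ᶠ_)
open import Data.Fin.Properties as Fin
  using (any?; all?; injective⇒≤; remQuot-combine)
  renaming (_<?_ to _<ᶠ?_; _≟_ to _≟ᶠ_)
open import Data.Fin.Subset using (Subset; Nonempty; ∣_∣; ⊤) renaming (_∈_ to _∈ˢ_)
open import Data.Fin.Subset.Properties using (_∈?_; nonempty?; ∈⊤; x∈p⇒∣p-x∣<∣p∣)
open import Data.Integer.Base as ℤ using (+_)
import Data.Integer.Properties as ℤ
open import Data.List.Base
  using (List; []; _∷_; [_]; length; lookup; filter; map; allFin; cartesianProduct; cartesianProductWith)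
open import Data.List.Membership.Propositional using (_∈_; lose)
open import Data.List.Membership.Propositional.Properties
  using (∈-cartesianProduct⁺; ∈-cartesianProductWith⁺; ∈-filter⁺; ∈-filter⁻; ∈-lookup; ∈-allFin; ∈-map⁺)
open import Data.List.Properties using (length-filter; length-tabulate)
open import Data.List.Relation.Binary.Sublist.Propositional using (⊆-refl)
open import Data.List.Relation.Binary.Sublist.Setoid.Properties using (length-mono-≤; filter⁺)
import Data.List.Relation.Unary.All as All
open import Data.List.Relation.Unary.AllPairs using (_∷_)
open import Data.List.Relation.Unary.Any as Any using (here; there)
open import Data.List.Relation.Unary.Any.Properties using (lookup-index)
open import Data.List.Relation.Unary.Unique.Propositional using (Unique)
import Data.List.Relation.Unary.Unique.Propositional.Properties as Unique
open import Data.Nat.Base as ℕ using (ℕ; NonZero; zero; suc; z≤n; s≤s)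
import Data.Nat.Properties as ℕ
open import Data.Product.Base using (∃; _×_; _,_; proj₁; proj₂; uncurry)
open import Data.Rational.Base as ℚ using (ℚ; _/_)
import Data.Rational.Properties as ℚ
import Data.Rational.Unnormalised.Base as ℚᵘ
import Data.Rational.Unnormalised.Properties as ℚᵘ
open import Data.Sum.Base using (_⊎_; inj₁; inj₂)
open import Data.Vec.Base as Vec using (Vec; []; _∷_)
open import Data.Vec.Properties using (lookup∘tabulate)
open import Function.Base using (_∘_)
open import Level using (Level; 0ℓ)
open import Relation.Binary.Bundles using (DecTotalOrder)
open import Relation.Binary.Core using (Rel)
open import Relation.Binary.Definitions
  using (Decidable; Irreflexive; Symmetric; Tri; tri<; tri≈; tri>)
open import Relation.Binary.PropositionalEquality
  using (_≡_; refl; sym; trans; cong; subst; setoid; isEquivalence)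
open import Relation.Binary.Structures using (IsStrictTotalOrder)
import Relation.Binary.Structures.Biased as Biased
open import Relation.Nullary using (Dec; yes; no; ¬_)
open import Relation.Nullary.Decidable
  using (_×-dec_; _⊎-dec_; _→-dec_; ¬?; map′; T?; ⌊_⌋; toWitness; fromWitness)
import Relation.Unary as U

open import Data.List.Extrema (DecTotalOrder.totalOrder ℚ.≤-decTotalOrder) using (argmax; f[xs]≤f[argmax])

private
  variable
    a p : Level
    A : Set a
    n : ℕ

-- Finite simple undirected graphs on the vertex set Fin n; nonemptiness is
-- imposed by NonZero n where it is needed.
record Graph (n : ℕ) : Set₁ where
  infix 4 _~_ _~?_
  field
    _~_      : Rel (Fin n) 0ℓ
    ~-sym    : Symmetric _~_
    ~-irrefl : Irreflexive _≡_ _~_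
    _~?_     : Decidable _~_

  -- An edge is listed once, smaller endpoint first.
  edges : List (Fin n × Fin n)
  edges = filter (λ (u , v) → (u <ᶠ? v) ×-dec (u ~? v))
                 (cartesianProduct (allFin n) (allFin n))

record Subgraph (G : Graph n) : Set₁ where
  private module G = Graph G
  field
    vertices  : Subset n
    nonempty  : Nonempty vertices
    -- The edge set, presented as a graph on all of Fin n.
    edgeGraph : Graph n
  open Graph edgeGraph public
  field
    edge⊆      : ∀ {u v} → u ~ v → u G.~ v
    endpoint∈  : ∀ {u v} → u ~ v → u ∈ˢ vertices

nonempty⇒nonZero : ∀ {W : Subset n} → Nonempty W → NonZero ∣ W ∣
nonempty⇒nonZero (_ , x∈W) = ℕ.>-nonZero (ℕ.≤-trans (s≤s z≤n) (x∈p⇒∣p-x∣<∣p∣ x∈W))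

averageDegree : {G : Graph n} → Subgraph G → ℚ
averageDegree H = _/_ (+ (2 ℕ.* length edges)) ∣ vertices ∣ {{nonempty⇒nonZero nonempty}}
  where open Subgraph H

IsMaximumAverageDegree : Graph n → ℚ → Set₁
IsMaximumAverageDegree G q =
  (∃ λ (H : Subgraph G) → averageDegree H ≡ q) × (∀ (H : Subgraph G) → averageDegree H ℚ.≤ q)

Nest : Rel A 0ℓ → A → A → A → A → Set
Nest _≺_ u v x y = (u ≺ x × x ≺ y × y ≺ v) ⊎ (x ≺ u × u ≺ v × v ≺ y)

-- The partition of the edge set is given by labelling each edge with its
-- queue. The values of queue on pairs that are not edges play no role.
record QueueLayout (G : Graph n) : Set₁ where
  open Graph G
  infix 4 _≺_
  field
    _≺_                : Rel (Fin n) 0ℓ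
    isStrictTotalOrder : IsStrictTotalOrder _≡_ _≺_
    #queues            : ℕ
    queue              : Fin n → Fin n → Fin #queues
    queue-sym          : ∀ u v → queue u v ≡ queue v u
    noNest             : ∀ u v x y → u ~ v → x ~ y → queue u v ≡ queue x y → ¬ Nest _≺_ u v x y

module _ (G : Graph n) where
  open Graph G

  queuesAt : ∀ {q} → (Fin n → Fin n → Fin q) → Fin n → List (Fin q)
  queuesAt queue v = filter (λ i → any? (λ w → (v ~? w) ×-dec (queue v w ≟ᶠ i))) (allFin _)

  IsLocal : ℕ → QueueLayout G → Set
  IsLocal ℓ L = ∀ v → length (queuesAt queue v) ℕ.≤ ℓ
    where open QueueLayout L

  HasLocalQueueLayout : ℕ → Set₁
  HasLocalQueueLayout ℓ = ∃ λ (L : QueueLayout G) → IsLocal ℓ L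

  IsLocalQueueNumber : ℕ → Set₁
  IsLocalQueueNumber ℓ = HasLocalQueueLayout ℓ × (∀ k → HasLocalQueueLayout k → ℓ ℕ.≤ k)

private
  allVec : List A → ∀ n → List (Vec A n)
  allVec xs zero    = [ [] ]
  allVec xs (suc n) = cartesianProductWith _∷_ xs (allVec xs n)

  ∈-allVec : ∀ {xs : List A} → (∀ x → x ∈ xs) → ∀ {n} (v : Vec A n) → v ∈ allVec xs n
  ∈-allVec all []      = here refl
  ∈-allVec all (x ∷ v) = ∈-cartesianProductWith⁺ _∷_ (all x) (∈-allVec all v)

  bools : List Bool
  bools = true ∷ false ∷ []

  ∈-bools : ∀ b → b ∈ bools
  ∈-bools true  = here refl
  ∈-bools false = there (here refl)

  Matrix : Set a → ℕ → Set a
  Matrix A n = Vec (Vec A n) n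

  entry : Matrix A n → Fin n → Fin n → A
  entry M i j = Vec.lookup (Vec.lookup M i) j

  matrix : (Fin n → Fin n → A) → Matrix A n
  matrix f = Vec.tabulate (λ i → Vec.tabulate (f i))

  entry∘matrix : (f : Fin n → Fin n → A) → ∀ i j → entry (matrix f) i j ≡ f i j
  entry∘matrix f i j = trans
    (cong (λ r → Vec.lookup r j) (lookup∘tabulate (λ i → Vec.tabulate (f i)) i))
    (lookup∘tabulate (f i) j)

  allMatrix : List A → ∀ n → List (Matrix A n)
  allMatrix xs n = allVec (allVec xs n) n

  ∈-allMatrix : ∀ {xs : List A} → (∀ x → x ∈ xs) → (M : Matrix A n) → M ∈ allMatrix xs n
  ∈-allMatrix all = ∈-allVec (∈-allVec all)

  least : {P : U.Pred ℕ p} → U.Decidable P → ∀ m → P m → ∃ λ ℓ → P ℓ × (∀ k → P k → ℓ ℕ.≤ k)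
  least P? m Pm with P? 0
  ... | yes P0 = 0 , P0 , λ _ _ → z≤n
  least P? zero    Pm | no ¬P0 = ⊥-elim (¬P0 Pm)
  least P? (suc m) Pm | no ¬P0 with least (P? ∘ suc) m Pm
  ... | ℓ , Pℓ , ℓ≤ = suc ℓ , Pℓ , λ { zero P0 → ⊥-elim (¬P0 P0) ; (suc k) Pk → s≤s (ℓ≤ k Pk) }

  unique⇒lookup-injective : ∀ {xs : List A} → Unique xs → ∀ i j → lookup xs i ≡ lookup xs j → i ≡ j
  unique⇒lookup-injective (_ ∷ _)   zero    zero    _  = refl
  unique⇒lookup-injective (x≢ ∷ _)  zero    (suc j) eq = ⊥-elim (All.lookup x≢ (∈-lookup j) eq)
  unique⇒lookup-injective (x≢ ∷ _)  (suc i) zero    eq = ⊥-elim (All.lookup x≢ (∈-lookup i) (sym eq))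
  unique⇒lookup-injective (_ ∷ u)   (suc i) (suc j) eq = cong suc (unique⇒lookup-injective u i j eq)

  covered⇒length≤ : ∀ {A B : Set} {xs : List A} {ys : List B} (g : B → A) → Unique xs →
                    (∀ {x} → x ∈ xs → ∃ λ y → y ∈ ys × g y ≡ x) → length xs ℕ.≤ length ys
  covered⇒length≤ {xs = xs} {ys} g uniq cover = injective⇒≤ {f = f} f-injective
    where
    c : ∀ i → ∃ λ y → y ∈ ys × g y ≡ lookup xs i
    c i = cover (∈-lookup i)

    f : Fin (length xs) → Fin (length ys)
    f i = Any.index (proj₁ (proj₂ (c i)))

    f-injective : ∀ {i j} → f i ≡ f j → i ≡ j
    f-injective {i} {j} eq = unique⇒lookup-injective uniq i j
      (trans (sym (proj₂ (proj₂ (c i)))) (trans (cong g yᵢ≡yⱼ) (proj₂ (proj₂ (c j)))))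
      where
      yᵢ≡yⱼ : proj₁ (c i) ≡ proj₁ (c j)
      yᵢ≡yⱼ = trans (lookup-index (proj₁ (proj₂ (c i))))
                    (trans (cong (lookup ys) eq) (sym (lookup-index (proj₁ (proj₂ (c j))))))

private
  /-monoˡ-≤ : ∀ {k m} d .{{_ : NonZero d}} → k ℕ.≤ m → (+ k) / d ℚ.≤ (+ m) / d
  /-monoˡ-≤ {k} {m} (suc d) k≤m = ℚ.toℚᵘ-cancel-≤
    (ℚᵘ.≤-trans (ℚᵘ.≤-reflexive (ℚ.toℚᵘ-fromℚᵘ (ℚᵘ.mkℚᵘ (+ k) d)))
    (ℚᵘ.≤-trans (ℚᵘ.*≤* (ℤ.*-monoʳ-≤-nonNeg (+ suc d) (ℤ.+≤+ k≤m)))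
                (ℚᵘ.≤-reflexive (ℚᵘ.≃-sym (ℚ.toℚᵘ-fromℚᵘ (ℚᵘ.mkℚᵘ (+ m) d))))))

  edges-mono : (G H : Graph n) → (∀ {u v} → Graph._~_ G u v → Graph._~_ H u v) →
               length (Graph.edges G) ℕ.≤ length (Graph.edges H)
  edges-mono {n} G H G⊆H = length-mono-≤ S
    (filter⁺ S (λ (u , v) → (u <ᶠ? v) ×-dec Graph._~?_ G u v)
               (λ (u , v) → (u <ᶠ? v) ×-dec Graph._~?_ H u v)
               (λ { refl (u<v , e) → u<v , G⊆H e })
               (⊆-refl {x = cartesianProduct (allFin n) (allFin n)}))
    where S = setoid (Fin n × Fin n)

  module _ (G : Graph n) where
    open Graph G

    induced : (W : Subset n) → Nonempty W → Subgraph G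
    induced W W≢∅ = record
      { vertices  = W
      ; nonempty  = W≢∅
      ; edgeGraph = record
        { _~_      = λ u v → u ~ v × u ∈ˢ W × v ∈ˢ W
        ; ~-sym    = λ (e , u∈ , v∈) → ~-sym e , v∈ , u∈
        ; ~-irrefl = λ eq (e , _) → ~-irrefl eq e
        ; _~?_     = λ u v → (u ~? v) ×-dec (u ∈? W) ×-dec (v ∈? W)
        }
      ; edge⊆     = proj₁
      ; endpoint∈ = proj₁ ∘ proj₂
      }

    ≤-induced : ∀ (H : Subgraph G) (ne : Nonempty (Subgraph.vertices H)) →
                averageDegree H ℚ.≤ averageDegree (induced (Subgraph.vertices H) ne)
    ≤-induced H ne = /-monoˡ-≤ ∣ H.vertices ∣ {{nonempty⇒nonZero H.nonempty}}
      (ℕ.*-monoʳ-≤ 2 (edges-mono H.edgeGraph (Subgraph.edgeGraph (induced H.vertices ne))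
        (λ e → H.edge⊆ e , H.endpoint∈ e , H.endpoint∈ (H.~-sym e))))
      where module H = Subgraph H

private
  maximiser : (f : A → ℚ) → A → (xs : List A) → ∃ λ m → ∀ {x} → x ∈ xs → f x ℚ.≤ f m
  maximiser f x₀ xs = argmax f x₀ xs , All.lookup (f[xs]≤f[argmax] {f = f} x₀ xs)

  inducedOn : (G : Graph (suc n)) (W : Subset (suc n)) → Dec (Nonempty W) → Subgraph G
  inducedOn G W (yes W≢∅) = induced G W W≢∅
  inducedOn G W (no  _)   = induced G ⊤ (zero , ∈⊤)

  ≤-inducedOn : ∀ (G : Graph (suc n)) (H : Subgraph G) d →
                averageDegree H ℚ.≤ averageDegree (inducedOn G (Subgraph.vertices H) d)
  ≤-inducedOn G H (yes W≢∅) = ≤-induced G H W≢∅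
  ≤-inducedOn G H (no  W≡∅) = ⊥-elim (W≡∅ (Subgraph.nonempty H))

-- Opaque, as is localQueueNumber-exists: mad and qnℓ are determined by their
-- specifications, and unfolding the searches would only slow down conversion.
opaque
  maximumAverageDegree-exists : .{{_ : NonZero n}} (G : Graph n) → ∃ (IsMaximumAverageDegree G)
  maximumAverageDegree-exists {suc n} G =
    averageDegree {G = G} (proj₁ best) , (proj₁ best , refl) , λ H →
      ℚ.≤-trans (≤-inducedOn G H (nonempty? (Subgraph.vertices H)))
                (proj₂ best (∈-map⁺ candidate (∈-allVec ∈-bools (Subgraph.vertices H))))
    where
    candidate : Subset (suc n) → Subgraph G
    candidate W = inducedOn G W (nonempty? W)

    best : ∃ λ m → ∀ {H} → H ∈ map candidate (allVec bools (suc n)) →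
                   averageDegree {G = G} H ℚ.≤ averageDegree {G = G} m
    best = maximiser (averageDegree {G = G}) (candidate ⊤) (map candidate (allVec bools (suc n)))

private
  tri? : ∀ {A B C : Set} → Dec A → Dec B → Dec C → Dec (Tri A B C)
  tri? (yes x) (no y)  (no z)  = yes (tri< x y z)
  tri? (no x)  (yes y) (no z)  = yes (tri≈ x y z)
  tri? (no x)  (no y)  (yes z) = yes (tri> x y z)
  tri? (yes x) (yes y) _       = no λ { (tri< _ ¬y _) → ¬y y ; (tri≈ ¬x _ _) → ¬x x ; (tri> ¬x _ _) → ¬x x }
  tri? (yes x) _       (yes z) = no λ { (tri< _ _ ¬z) → ¬z z ; (tri≈ ¬x _ _) → ¬x x ; (tri> ¬x _ _) → ¬x x }
  tri? _       (yes y) (yes z) = no λ { (tri< _ ¬y _) → ¬y y ; (tri≈ _ _ ¬z) → ¬z z ; (tri> _ ¬y _) → ¬y y }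
  tri? (no x)  (no y)  (no z)  = no λ { (tri< x′ _ _) → x x′ ; (tri≈ _ y′ _) → y y′ ; (tri> _ _ z′) → z z′ }

  module Search {n} .{{_ : NonZero n}} (G : Graph n) where
    open Graph G
    open Biased (_≡_ {A = Fin n}) using (isStrictTotalOrderᶜ)

    module _ {q} (_≺_ : Rel (Fin n) 0ℓ) (queue : Fin n → Fin n → Fin q) (ℓ : ℕ) where
      Valid : Set
      Valid = (∀ x y z → x ≺ y → y ≺ z → x ≺ z)
            × (∀ x y → Tri (x ≺ y) (x ≡ y) (y ≺ x))
            × (∀ u v → queue u v ≡ queue v u)
            × (∀ u v x y → u ~ v → x ~ y → queue u v ≡ queue x y → ¬ Nest _≺_ u v x y)
            × (∀ v → length (queuesAt G queue v) ℕ.≤ ℓ)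

      valid? : Decidable _≺_ → Dec Valid
      valid? _≺?_ =
        all? (λ x → all? λ y → all? λ z → (x ≺? y) →-dec (y ≺? z) →-dec (x ≺? z))
        ×-dec all? (λ x → all? λ y → tri? (x ≺? y) (x ≟ᶠ y) (y ≺? x))
        ×-dec all? (λ u → all? λ v → queue u v ≟ᶠ queue v u)
        ×-dec all? (λ u → all? λ v → all? λ x → all? λ y →
                (u ~? v) →-dec (x ~? y) →-dec (queue u v ≟ᶠ queue x y) →-dec
                ¬? (((u ≺? x) ×-dec (x ≺? y) ×-dec (y ≺? v)) ⊎-dec
                    ((x ≺? u) ×-dec (u ≺? v) ×-dec (v ≺? y))))
        ×-dec all? (λ v → length (queuesAt G queue v) ℕ.≤? ℓ)

      fromValid : Valid → HasLocalQueueLayout G ℓ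
      fromValid (tr , tri , qs , nn , loc) = record
        { _≺_                = _≺_
        ; isStrictTotalOrder = isStrictTotalOrderᶜ record
          { isEquivalence = isEquivalence ; trans = tr _ _ _ ; compare = tri }
        ; #queues   = q
        ; queue     = queue
        ; queue-sym = qs
        ; noNest    = nn
        } , loc

    -- n * n queues are enough: rename each queue to one of the pairs it labels.
    Code : Set
    Code = Matrix Bool n × Matrix (Fin (n ℕ.* n)) n

    codes : List Code
    codes = cartesianProduct (allMatrix bools n) (allMatrix (allFin _) n)

    ∈-codes : ∀ c → c ∈ codes
    ∈-codes (M , Q) = ∈-cartesianProduct⁺ (∈-allMatrix ∈-bools M) (∈-allMatrix ∈-allFin Q)

    ValidCode : ℕ → Code → Set
    ValidCode ℓ (M , Q) = Valid (λ x y → T (entry M x y)) (entry Q) ℓ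

    validCode? : ∀ ℓ → U.Decidable (ValidCode ℓ)
    validCode? ℓ (M , Q) = valid? _ _ ℓ (λ x y → T? (entry M x y))

    encode : ∀ {ℓ} → HasLocalQueueLayout G ℓ → ∃ (ValidCode ℓ)
    encode {ℓ} (L , loc) = (M , Q) , transL , triL , symL , nestL , locL
      where
      open QueueLayout L
      open IsStrictTotalOrder isStrictTotalOrder
        using (compare) renaming (trans to ≺-trans; _<?_ to _≺?_)

      pair : Fin (n ℕ.* n) → Fin n × Fin n
      pair = remQuot {n} n

      labelled? : ∀ i → Dec (∃ λ p → uncurry queue (pair p) ≡ i)
      labelled? i = any? (λ p → uncurry queue (pair p) ≟ᶠ i)

      default : Fin n
      default = fromℕ< (ℕ.>-nonZero⁻¹ n)

      pick : ∀ {i} → Dec (∃ λ p → uncurry queue (pair p) ≡ i) → Fin (n ℕ.* n)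
      pick (yes (p , _)) = p
      pick (no _)        = combine default default

      rep : Fin #queues → Fin (n ℕ.* n)
      rep i = pick (labelled? i)

      queue-pick : ∀ u v d → uncurry queue (pair (pick {queue u v} d)) ≡ queue u v
      queue-pick u v (yes (_ , eq)) = eq
      queue-pick u v (no ¬e) = ⊥-elim (¬e (combine u v , cong (uncurry queue) (remQuot-combine u v)))

      queue-rep : ∀ u v → uncurry queue (pair (rep (queue u v))) ≡ queue u v
      queue-rep u v = queue-pick u v (labelled? (queue u v))

      M : Matrix Bool n
      M = matrix (λ x y → ⌊ x ≺? y ⌋)

      Q : Matrix (Fin (n ℕ.* n)) n
      Q = matrix (λ u v → rep (queue u v))

      to : ∀ {x y} → T (entry M x y) → x ≺ y
      to {x} {y} t = toWitness {a? = x ≺? y} (subst T (entry∘matrix _ x y) t)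

      from : ∀ {x y} → x ≺ y → T (entry M x y)
      from {x} {y} x≺y = subst T (sym (entry∘matrix _ x y)) (fromWitness {a? = x ≺? y} x≺y)

      Q≡ : ∀ u v → entry Q u v ≡ rep (queue u v)
      Q≡ = entry∘matrix _

      Q-injective : ∀ u v x y → entry Q u v ≡ entry Q x y → queue u v ≡ queue x y
      Q-injective u v x y eq = trans (sym (queue-rep u v))
        (trans (cong (uncurry queue ∘ pair) (trans (sym (Q≡ u v)) (trans eq (Q≡ x y))))
               (queue-rep x y))

      transL : ∀ x y z → T (entry M x y) → T (entry M y z) → T (entry M x z)
      transL x y z s t = from (≺-trans (to {x} {y} s) (to {y} {z} t))

      triL : ∀ x y → Tri (T (entry M x y)) (x ≡ y) (T (entry M y x))
      triL x y with compare x y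
      ... | tri< b ¬c ¬d = tri< (from b) ¬c (¬d ∘ to)
      ... | tri≈ ¬b c ¬d = tri≈ (¬b ∘ to) c (¬d ∘ to)
      ... | tri> ¬b ¬c d = tri> (¬b ∘ to) ¬c (from d)

      symL : ∀ u v → entry Q u v ≡ entry Q v u
      symL u v = trans (Q≡ u v) (trans (cong rep (queue-sym u v)) (sym (Q≡ v u)))

      nestL : ∀ u v x y → u ~ v → x ~ y → entry Q u v ≡ entry Q x y →
              ¬ Nest (λ i j → T (entry M i j)) u v x y
      nestL u v x y e f eq nest = noNest u v x y e f (Q-injective u v x y eq) (nest′ nest)
        where
        nest′ : Nest (λ i j → T (entry M i j)) u v x y → Nest _≺_ u v x y
        nest′ (inj₁ (r , s , t)) = inj₁ (to r , to s , to t)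
        nest′ (inj₂ (r , s , t)) = inj₂ (to r , to s , to t)

      locL : ∀ v → length (queuesAt G (entry Q) v) ℕ.≤ ℓ
      locL v = ℕ.≤-trans (covered⇒length≤ rep (Unique.filter⁺ _ (Unique.allFin⁺ _)) cover) (loc v)
        where
        cover : ∀ {i} → i ∈ queuesAt G (entry Q) v → ∃ λ j → j ∈ queuesAt G queue v × rep j ≡ i
        cover i∈ with ∈-filter⁻ _ {xs = allFin _} i∈
        ... | _ , w , e , eq =
          queue v w , ∈-filter⁺ _ (∈-allFin _) (w , e , refl) , trans (sym (Q≡ v w)) eq

    hasLocalQueueLayout? : U.Decidable (HasLocalQueueLayout G)
    hasLocalQueueLayout? ℓ = map′ decode
      (λ l → let c , valid = encode l in lose (∈-codes c) valid)
      (Any.any? (validCode? ℓ) codes)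
      where
      decode : Any.Any (ValidCode ℓ) codes → HasLocalQueueLayout G ℓ
      decode c = let (M , Q) , valid = Any.satisfied c in fromValid _ _ ℓ valid

    -- Put each edge in the queue named by its larger endpoint.
    larger : Fin n → Fin n → Fin n
    larger u v with Fin.<-cmp u v
    ... | tri< _ _ _ = v
    ... | tri≈ _ _ _ = u
    ... | tri> _ _ _ = u

    larger-sym : ∀ u v → larger u v ≡ larger v u
    larger-sym u v with Fin.<-cmp u v | Fin.<-cmp v u
    ... | tri< _ _ _   | tri> _ _ _   = refl
    ... | tri≈ _ _ _   | tri≈ _ eq _  = sym eq
    ... | tri≈ _ eq _  | tri> _ _ _   = eq
    ... | tri≈ _ eq _  | tri< _ _ _   = refl
    ... | tri> _ _ _   | tri< _ _ _   = refl
    ... | tri> _ _ _   | tri≈ _ eq _  = sym eq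
    ... | tri< p _ _   | tri< _ _ ¬p  = ⊥-elim (¬p p)
    ... | tri< p _ _   | tri≈ _ _ ¬p  = ⊥-elim (¬p p)
    ... | tri> _ _ p   | tri> ¬p _ _  = ⊥-elim (¬p p)

    larger-< : ∀ {u v} → u <ᶠ v → larger u v ≡ v
    larger-< {u} {v} u<v with Fin.<-cmp u v
    ... | tri< _ _ _  = refl
    ... | tri≈ ¬p _ _ = ⊥-elim (¬p u<v)
    ... | tri> ¬p _ _ = ⊥-elim (¬p u<v)

    starLayout : HasLocalQueueLayout G n
    starLayout = record
      { _≺_                = _<ᶠ_
      ; isStrictTotalOrder = Fin.<-isStrictTotalOrder
      ; #queues            = n
      ; queue              = larger
      ; queue-sym          = larger-sym
      ; noNest             = λ where
          u v x y _ _ eq (inj₁ (u<x , x<y , y<v)) → Fin.<-irrefl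
            (trans (sym (larger-< x<y)) (trans (sym eq) (larger-< (Fin.<-trans u<x (Fin.<-trans x<y y<v))))) y<v
          u v x y _ _ eq (inj₂ (x<u , u<v , v<y)) → Fin.<-irrefl
            (trans (sym (larger-< u<v)) (trans eq (larger-< (Fin.<-trans x<u (Fin.<-trans u<v v<y))))) v<y
      } , λ v → ℕ.≤-trans (length-filter _ (allFin n)) (ℕ.≤-reflexive (length-tabulate {n = n} (λ i → i)))

opaque
  localQueueNumber-exists : .{{_ : NonZero n}} (G : Graph n) → ∃ (IsLocalQueueNumber G)
  localQueueNumber-exists {n} G = least hasLocalQueueLayout? n starLayout
    where open Search G

mad : .{{_ : NonZero n}} → Graph n → ℚ
mad G = proj₁ (maximumAverageDegree-exists G)

mad-isMaximumAverageDegree : .{{_ : NonZero n}} (G : Graph n) → IsMaximumAverageDegree G (mad G)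
mad-isMaximumAverageDegree G = proj₂ (maximumAverageDegree-exists G)

qnℓ : .{{_ : NonZero n}} → Graph n → ℕ
qnℓ G = proj₁ (localQueueNumber-exists G)

qnℓ-isLocalQueueNumber : .{{_ : NonZero n}} (G : Graph n) → IsLocalQueueNumber G (qnℓ G)
qnℓ-isLocalQueueNumber G = proj₂ (localQueueNumber-exists G)

module Submission where

-- Lower bound. Within one queue every edge can be charged to one of its two
-- ends so that each vertex is charged at most twice. Hence an ℓ-local layout
-- has at most 2ℓ|W| edges inside any vertex set W.
-- Upper bound. Let d = ⌊mad/2⌋ + 1, so that every subgraph H has at most d|V(H)|
-- edges and, by Hakimi's theorem, G has an orientation of outdegree at most d.
-- The edges with a given head form a star, and a star is a queue in any vertex
-- order, as edges sharing an end do not nest. A vertex meets at most one star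
-- per outgoing edge, plus the star centred at itself.

open import Defs
open import Data.Bool.Base using (Bool; true; false; not; if_then_else_)
open import Data.Fin.Base using (Fin; zero; suc; combine; inject≤) renaming (_<_ to _<ᶠ_)
open import Data.Fin.Properties as Fin
  using (any?; all?; ¬∀⟶∃¬; combine-injective; inject≤-injective; injective⇒≤)
  renaming (_≟_ to _≟ᶠ_; _<?_ to _<ᶠ?_)
open import Data.Fin.Subset using (Subset; Nonempty; ∣_∣; inside; outside) renaming (_∈_ to _∈ˢ_)
open import Data.Fin.Subset.Properties using (_∈?_)
open import Data.Integer.Base as ℤ using (+_)
import Data.Integer.Properties as ℤ
open import Data.List.Base as List using (List; []; _∷_; length; filter; allFin; lookup; cartesianProduct)
open import Data.List.Membership.Propositional using (_∈_)
open import Data.List.Membership.Propositional.Properties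
  using (∈-filter⁺; ∈-filter⁻; ∈-cartesianProduct⁺; ∈-allFin; ∈-lookup)
open import Data.List.Membership.Setoid.Properties using (index-injective)
open import Data.List.Properties using (tabulate-lookup)
import Data.List.Relation.Unary.All as All
open import Data.List.Relation.Unary.AllPairs using (_∷_)
open import Data.List.Relation.Unary.Any using (index)
open import Data.List.Relation.Unary.Any.Properties using (lookup-index)
open import Data.List.Relation.Unary.Unique.Propositional using (Unique)
import Data.List.Relation.Unary.Unique.Propositional.Properties as Unique
open import Data.Nat.Base using (ℕ; NonZero; zero; suc; z≤n; s≤s)
open import Data.Product.Base using (∃; _×_; _,_; proj₁; proj₂; swap)
open import Data.Product.Properties using (≡-dec)
import Data.Rational.Base as ℚ
import Data.Rational.Properties as ℚ
import Data.Rational.Unnormalised.Base as ℚᵘ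
import Data.Rational.Unnormalised.Properties as ℚᵘ
open import Data.Sum.Base as Sum using (_⊎_; inj₁; inj₂)
open import Data.Vec.Base as Vec using ([]; _∷_; here; there)
import Data.Vec.Functional as F
open import Data.Vec.Functional.Properties using (updateAt-updates; updateAt-minimal)
open import Data.Vec.Properties using (lookup∘tabulate; []=⇒lookup; lookup⇒[]=)
open import Function.Base using (_∘_; id)
open import Relation.Binary.Definitions using (tri<; tri≈; tri>)
open import Relation.Binary.PropositionalEquality
  using (_≡_; _≢_; refl; sym; trans; cong; cong₂; subst; subst₂; ≢-sym; setoid)
open import Relation.Binary.Structures using (IsStrictTotalOrder)
open import Relation.Nullary using (Dec; yes; no; ¬_; does; contradiction)
open import Relation.Nullary.Decidable using (_×-dec_; _⊎-dec_; _→-dec_; ¬?; dec-true; dec-false)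
import Relation.Unary as U

import Algebra.Construct.NaturalChoice.Max as Max
import Algebra.Construct.NaturalChoice.Min as Min

module LocalQueueLayouts where
  open import Data.Nat.Base using (_+_; _*_; _/_; _≤_; _<_)
  open import Data.Nat.DivMod using (m≡m%n+[m/n]*n; m%n<n; m/n*n≤m)
  open import Data.Nat.Properties hiding (⊓-comm; ⊔-comm)
  open import Data.Nat.Tactic.RingSolver using (solve-∀)
  open import Algebra.Properties.CommutativeMonoid.Sum +-0-commutativeMonoid
    using (sum; sum-syntax; sum-cong-≗; ∑-comm; ∑-distrib-+; sum-replicate-zero)
  open import Algebra.Properties.Semiring.Sum +-*-semiring using (*-distribˡ-sum)

  private
    variable
      A P Q : Set
      m n : ℕ

  -- Indicators of decidable propositions and finite sums.

  ⟦_⟧ : Dec P → ℕ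
  ⟦ p? ⟧ = if does p? then 1 else 0

  ⟦⟧-yes : (p? : Dec P) → P → ⟦ p? ⟧ ≡ 1
  ⟦⟧-yes p? p rewrite dec-true p? p = refl

  ⟦⟧-no : (p? : Dec P) → ¬ P → ⟦ p? ⟧ ≡ 0
  ⟦⟧-no p? ¬p rewrite dec-false p? ¬p = refl

  ⟦⟧-≤1 : (p? : Dec P) → ⟦ p? ⟧ ≤ 1
  ⟦⟧-≤1 (yes _) = ≤-refl
  ⟦⟧-≤1 (no _)  = z≤n

  ⟦⟧-mono : (p? : Dec P) (q? : Dec Q) → (P → Q) → ⟦ p? ⟧ ≤ ⟦ q? ⟧
  ⟦⟧-mono (yes p) q? f = ≤-reflexive (sym (⟦⟧-yes q? (f p)))
  ⟦⟧-mono (no _)  q? f = z≤n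

  sum-mono-≤ : ∀ {f g : Fin n → ℕ} → (∀ i → f i ≤ g i) → sum f ≤ sum g
  sum-mono-≤ {zero}  f≤g = z≤n
  sum-mono-≤ {suc n} f≤g = +-mono-≤ (f≤g zero) (sum-mono-≤ (f≤g ∘ suc))

  sum-mono-< : ∀ {f g : Fin n → ℕ} → (∀ i → f i ≤ g i) → ∀ i → f i < g i → sum f < sum g
  sum-mono-< f≤g zero    fi<gi = +-mono-<-≤ fi<gi (sum-mono-≤ (f≤g ∘ suc))
  sum-mono-< f≤g (suc i) fi<gi = +-mono-≤-< (f≤g zero) (sum-mono-< (f≤g ∘ suc) i fi<gi)

  term≤sum : ∀ (f : Fin n → ℕ) i → f i ≤ sum f
  term≤sum f zero    = m≤m+n _ _
  term≤sum f (suc i) = ≤-trans (term≤sum (f ∘ suc) i) (m≤n+m _ _)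

  -- Both sides equal `f i + g i` plus the common sum over the other indices. The additive form
  -- avoids subtraction in ℕ.
  sum-agree-off : ∀ {f g : Fin n → ℕ} i → (∀ j → j ≢ i → f j ≡ g j) → f i + sum g ≡ g i + sum f
  sum-agree-off {f = f} {g} zero f≗g
    rewrite sum-cong-≗ {_} {f ∘ suc} {g ∘ suc} (λ j → f≗g (suc j) λ ()) = lemma (f zero) (g zero) _
    where
    lemma : ∀ x y z → x + (y + z) ≡ y + (x + z)
    lemma = solve-∀
  sum-agree-off {f = f} {g} (suc i) f≗g = trans (lemma (f (suc i)) (g zero) _)
    (trans (cong₂ _+_ (sym (f≗g zero λ ())) (sum-agree-off i λ j j≢i → f≗g (suc j) λ { refl → j≢i refl }))
           (lemma (f zero) (g (suc i)) _))
    where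
    lemma : ∀ x y z → x + (y + z) ≡ y + (x + z)
    lemma = solve-∀

  -- This collapses the inner sum once a double sum over vertices and arcs has been swapped: each
  -- arc has exactly one tail and one head.
  sum-pick : ∀ (x : Fin n) (f : Fin n → ℕ) → ∑[ y < n ] (⟦ x ≟ᶠ y ⟧ * f y) ≡ f x
  sum-pick {suc n} zero    f = trans
    (cong₂ _+_ (*-identityˡ (f zero)) (sum-replicate-zero n)) (+-identityʳ (f zero))
  sum-pick {suc n} (suc x) f = sum-pick x (f ∘ suc)

  sum-⟦⟧≤n : {P : Fin n → Set} (P? : U.Decidable P) → ∑[ i < n ] ⟦ P? i ⟧ ≤ n
  sum-⟦⟧≤n {zero}  P? = z≤n
  sum-⟦⟧≤n {suc n} P? = +-mono-≤ (⟦⟧-≤1 (P? zero)) (sum-⟦⟧≤n (P? ∘ suc))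

  ∣p∣≡sum : ∀ (W : Subset n) → ∣ W ∣ ≡ ∑[ x < n ] ⟦ x ∈? W ⟧
  ∣p∣≡sum Vec.[]              = refl
  ∣p∣≡sum (inside  Vec.∷ W) = cong suc (∣p∣≡sum W)
  ∣p∣≡sum (outside Vec.∷ W) = ∣p∣≡sum W

  length-filter-tabulate : {P : A → Set} (P? : U.Decidable P) (f : Fin n → A) →
                           length (filter P? (List.tabulate f)) ≡ ∑[ i < n ] ⟦ P? (f i) ⟧
  length-filter-tabulate {n = zero}  P? f = refl
  length-filter-tabulate {n = suc n} P? f with does (P? (f zero))
  ... | true  = cong suc (length-filter-tabulate P? (f ∘ suc))
  ... | false = length-filter-tabulate P? (f ∘ suc)

  -- Every step that is not yet stable adds an element of `Fin n`, which can happen at most `n`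
  -- times.
  increasing⇒stable : {R : ℕ → Fin n → Set} → (∀ k → U.Decidable (R k)) →
                      (∀ {k y} → R k y → R (suc k) y) →
                      ∃ λ k → ∀ y → R (suc k) y → R k y
  increasing⇒stable {n} {R} R? R-suc = search n 0 (m≤m+n n _)
    where
    # : ℕ → ℕ
    # k = ∑[ y < n ] ⟦ R? k y ⟧

    grows : ∀ k y → ¬ (R (suc k) y → R k y) → # k < # (suc k)
    grows k y ¬stable = sum-mono-< (λ z → ⟦⟧-mono (R? k z) (R? (suc k) z) R-suc) y strict
      where
      strict : ⟦ R? k y ⟧ < ⟦ R? (suc k) y ⟧
      strict with R? k y | R? (suc k) y
      ... | yes r | _     = contradiction (λ _ → r) ¬stable
      ... | no _  | yes _ = s≤s z≤n
      ... | no _  | no ¬r = contradiction (λ r → contradiction r ¬r) ¬stable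

    -- `fuel` bounds the growth still possible. At zero all `n` elements are present, so another
    -- strict step would count more than `n`.
    search : ∀ fuel k → n ≤ fuel + # k → ∃ λ k → ∀ y → R (suc k) y → R k y
    search fuel k n≤ with all? (λ y → R? (suc k) y →-dec R? k y)
    ... | yes stable = k , stable
    ... | no ¬stable with ¬∀⟶∃¬ n _ (λ y → R? (suc k) y →-dec R? k y) ¬stable
    search zero       k n≤ | no _ | y , ¬y =
      contradiction (≤-trans (s≤s n≤) (≤-trans (grows k y ¬y) (sum-⟦⟧≤n (R? (suc k))))) 1+n≰n
    search (suc fuel) k n≤ | no _ | y , ¬y = search fuel (suc k)
      (≤-trans n≤ (≤-trans (≤-reflexive (sym (+-suc fuel (# k)))) (+-monoʳ-≤ fuel (grows k y ¬y))))

  -- Orientations of bounded outdegree: Hakimi's theorem by augmenting paths.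

  -- An orientation of a family of edges: true keeps an edge, false reverses it.
  Orientation : ℕ → Set
  Orientation m = Fin m → Bool

  arc : Bool → A × A → A × A
  arc true  e = e
  arc false e = swap e

  module _ (ends : Fin m → Fin n × Fin n) where
    tl hd : Orientation m → Fin m → Fin n
    tl b e = proj₁ (arc (b e) (ends e))
    hd b e = proj₂ (arc (b e) (ends e))

    outdegree : Orientation m → Fin n → ℕ
    outdegree b y = ∑[ e < m ] ⟦ tl b e ≟ᶠ y ⟧

    edgesWithin : Subset n → ℕ
    edgesWithin W = ∑[ e < m ] ⟦ (proj₁ (ends e) ∈? W) ×-dec (proj₂ (ends e) ∈? W) ⟧

    flip : Orientation m → Fin m → Orientation m
    flip b e = F.updateAt b e not

    tl-flip : ∀ b e → tl (flip b e) e ≡ hd b e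
    tl-flip b e rewrite updateAt-updates e {not} b with b e
    ... | true  = refl
    ... | false = refl

    tl-flip-≢ : ∀ b e {f} → f ≢ e → tl (flip b e) f ≡ tl b f
    tl-flip-≢ b e {f} f≢e = cong (λ c → proj₁ (arc c (ends f))) (updateAt-minimal f e b f≢e)

    hd-flip-≢ : ∀ b e {f} → f ≢ e → hd (flip b e) f ≡ hd b f
    hd-flip-≢ b e {f} f≢e = cong (λ c → proj₂ (arc c (ends f))) (updateAt-minimal f e b f≢e)

    -- Only the term of `e` changes, its new tail being its old head. No assumption on loops is
    -- needed in this form; the cases below specialise it to arcs with distinct ends.
    outdegree-flip : ∀ b e y → ⟦ tl b e ≟ᶠ y ⟧ + outdegree (flip b e) y ≡ ⟦ hd b e ≟ᶠ y ⟧ + outdegree b y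
    outdegree-flip b e y = trans
      (sum-agree-off e (λ f f≢e → cong (λ z → ⟦ z ≟ᶠ y ⟧) (sym (tl-flip-≢ b e f≢e))))
      (cong (λ z → ⟦ z ≟ᶠ y ⟧ + outdegree b y) (tl-flip b e))

    module _ (b : Orientation m) (e : Fin m) (tl≢hd : tl b e ≢ hd b e) where
      private
        b′ = flip b e
        u  = tl b e
        x  = hd b e

      outdegree-flip-hd : outdegree b′ x ≡ suc (outdegree b x)
      outdegree-flip-hd = trans (cong (_+ outdegree b′ x) (sym (⟦⟧-no (u ≟ᶠ x) tl≢hd)))
        (trans (outdegree-flip b e x) (cong (_+ outdegree b x) (⟦⟧-yes (x ≟ᶠ x) refl)))

      outdegree-flip-tl : suc (outdegree b′ u) ≡ outdegree b u
      outdegree-flip-tl = trans (cong (_+ outdegree b′ u) (sym (⟦⟧-yes (u ≟ᶠ u) refl)))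
        (trans (outdegree-flip b e u) (cong (_+ outdegree b u) (⟦⟧-no (x ≟ᶠ u) (≢-sym tl≢hd))))

      outdegree-flip-≢ : ∀ {y} → y ≢ u → y ≢ x → outdegree b′ y ≡ outdegree b y
      outdegree-flip-≢ {y} y≢u y≢x = trans (cong (_+ outdegree b′ y) (sym (⟦⟧-no (u ≟ᶠ y) (≢-sym y≢u))))
        (trans (outdegree-flip b e y) (cong (_+ outdegree b y) (⟦⟧-no (x ≟ᶠ y) (≢-sym y≢x))))

    module _ (d : ℕ) where
      -- A directed path of at most `k` arcs from `y` to a vertex with spare outdegree. Including
      -- the shorter paths makes these sets increase with `k`.
      Reach : Orientation m → ℕ → Fin n → Set
      Reach b zero    y = outdegree b y < d
      Reach b (suc k) y = Reach b k y ⊎ ∃ λ e → tl b e ≡ y × Reach b k (hd b e)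

      reach? : ∀ b k → U.Decidable (Reach b k)
      reach? b zero    y = outdegree b y <? d
      reach? b (suc k) y = reach? b k y ⊎-dec any? (λ e → (tl b e ≟ᶠ y) ×-dec reach? b k (hd b e))

      Bounded : Orientation m → Set
      Bounded b = ∀ y → outdegree b y ≤ d

      bounded : ∀ b u → (∀ y → y ≢ u → outdegree b y ≤ d) → outdegree b u ≤ d → Bounded b
      bounded b u rest at-u y with y ≟ᶠ u
      ... | yes refl = at-u
      ... | no y≢u   = rest y y≢u

      -- A path that used `e` would pass through its tail, which by assumption does not reach that
      -- soon; so the path survives the flip. Its last vertex is neither end of `e`: the tail does
      -- not reach, and the head has no spare outdegree. So its outdegree is unchanged.
      reach-flip : ∀ b e → tl b e ≢ hd b e → ¬ (outdegree b (hd b e) < d) →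
                   ∀ k → ¬ Reach b k (tl b e) → ∀ y → Reach b k y → Reach (flip b e) k y
      reach-flip b e tl≢hd hd≮d zero ¬r y r = subst (_< d)
        (sym (outdegree-flip-≢ b e tl≢hd (λ { refl → ¬r r }) (λ { refl → hd≮d r }))) r
      reach-flip b e tl≢hd hd≮d (suc k) ¬r y (inj₁ r) =
        inj₁ (reach-flip b e tl≢hd hd≮d k (¬r ∘ inj₁) y r)
      reach-flip b e tl≢hd hd≮d (suc k) ¬r y (inj₂ (f , refl , r)) =
        inj₂ (f , tl-flip-≢ b e f≢e , subst (Reach (flip b e) k) (sym (hd-flip-≢ b e f≢e))
                                            (reach-flip b e tl≢hd hd≮d k (¬r ∘ inj₁) (hd b f) r))
        where
        f≢e : f ≢ e
        f≢e refl = ¬r (inj₂ (f , refl , r))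

      -- Flipping the first arc of a path moves the excess one step along it.
      augment : ∀ k b u → (∀ y → y ≢ u → outdegree b y ≤ d) → outdegree b u ≤ suc d →
                Reach b k u → ∃ Bounded
      augment zero    b u rest at-u u<d = b , bounded b u rest (<⇒≤ u<d)
      augment (suc k) b u rest at-u (inj₁ r) = augment k b u rest at-u r
      augment (suc k) b .(tl b e) rest at-u (inj₂ (e , refl , r)) with reach? b k (tl b e)
      -- A shorter path is preferred. Otherwise the tail does not reach within `k` arcs, which is
      -- what keeps the remaining path intact under the flip.
      ... | yes r′ = augment k b (tl b e) rest at-u r′
      ... | no  ¬r = step (outdegree b (hd b e) <? d)
        where
        tl≢hd : tl b e ≢ hd b e
        tl≢hd eq = ¬r (subst (Reach b k) (sym eq) r)

        at-hd : outdegree (flip b e) (hd b e) ≡ suc (outdegree b (hd b e))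
        at-hd = outdegree-flip-hd b e tl≢hd

        rest′ : ∀ y → y ≢ hd b e → outdegree (flip b e) y ≤ d
        rest′ y y≢hd with y ≟ᶠ tl b e
        ... | yes refl = ≤-pred (≤-trans (≤-reflexive (outdegree-flip-tl b e tl≢hd)) at-u)
        ... | no y≢tl  = ≤-trans (≤-reflexive (outdegree-flip-≢ b e tl≢hd y≢tl y≢hd)) (rest y y≢tl)

        -- A head with spare outdegree absorbs the extra arc. A full head ends with at most `d + 1`
        -- and becomes the new excess vertex, one arc further along.
        step : Dec (outdegree b (hd b e) < d) → ∃ Bounded
        step (yes hd<d) = flip b e , bounded (flip b e) (hd b e) rest′ (≤-trans (≤-reflexive at-hd) hd<d)
        step (no  hd≮d) = augment k (flip b e) (hd b e) rest′
          (≤-trans (≤-reflexive at-hd) (s≤s (rest (hd b e) (≢-sym tl≢hd))))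
          (reach-flip b e tl≢hd hd≮d k ¬r (hd b e) r)

      -- The vertices that reach no vertex of outdegree less than d span too many edges.
      excess⇒reach : (∀ W → Nonempty W → edgesWithin W ≤ d * ∣ W ∣) →
                     ∀ b u → d < outdegree b u → ∃ λ k → Reach b k u
      excess⇒reach sparse b u d<u with increasing⇒stable (reach? b) inj₁
      ... | k , stable with reach? b k u
      ...   | yes r = k , r
      ...   | no ¬r = contradiction (sparse W (u , ∈W ¬r)) (<⇒≱ dense)
        where
        W : Subset n
        W = Vec.tabulate (λ y → does (¬? (reach? b k y)))

        ∈W : ∀ {y} → ¬ Reach b k y → y ∈ˢ W
        ∈W {y} ¬r = lookup⇒[]= y W (trans (lookup∘tabulate _ y) (dec-true (¬? (reach? b k y)) ¬r))

        W⇒¬reach : ∀ {y} → y ∈ˢ W → ¬ Reach b k y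
        W⇒¬reach {y} y∈W r
          with trans (sym (trans (lookup∘tabulate _ y) (dec-false (¬? (reach? b k y)) (λ ¬r → ¬r r))))
                     ([]=⇒lookup y∈W)
        ... | ()

        ¬reach⇒d≤ : ∀ j {y} → ¬ Reach b j y → d ≤ outdegree b y
        ¬reach⇒d≤ zero    ¬r = ≮⇒≥ ¬r
        ¬reach⇒d≤ (suc j) ¬r = ¬reach⇒d≤ j (¬r ∘ inj₁)

        -- An arc leaving `W` would let its tail reach within `k + 1` arcs, hence by stability
        -- within `k`, contradicting membership in `W`.
        closed : ∀ e → tl b e ∈ˢ W → hd b e ∈ˢ W
        closed e tl∈ = ∈W λ r → W⇒¬reach tl∈ (stable (tl b e) (inj₂ (e , refl , r)))

        within : ∀ e → tl b e ∈ˢ W → proj₁ (ends e) ∈ˢ W × proj₂ (ends e) ∈ˢ W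
        within e tl∈ with b e | closed e
        ... | true  | hd∈ = tl∈ , hd∈ tl∈
        ... | false | hd∈ = hd∈ tl∈ , tl∈

        within? : ∀ e → Dec (proj₁ (ends e) ∈ˢ W × proj₂ (ends e) ∈ˢ W)
        within? e = (proj₁ (ends e) ∈? W) ×-dec (proj₂ (ends e) ∈? W)

        in-W : ∀ y → ⟦ y ∈? W ⟧ * d ≤ ⟦ y ∈? W ⟧ * outdegree b y
        in-W y with y ∈? W
        ... | yes y∈ = +-monoˡ-≤ 0 (¬reach⇒d≤ k (W⇒¬reach y∈))
        ... | no _   = z≤n

        at-u : ⟦ u ∈? W ⟧ * d < ⟦ u ∈? W ⟧ * outdegree b u
        at-u rewrite ⟦⟧-yes (u ∈? W) (∈W ¬r) = +-monoˡ-< 0 d<u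

        open ≤-Reasoning

        -- Double counting of the arcs with tail in `W`. Each vertex of `W` emits at least `d` of
        -- them and `u` more than `d`, while every such arc has both ends in `W`.
        dense : d * ∣ W ∣ < edgesWithin W
        dense = begin-strict
          d * ∣ W ∣                                             ≡⟨ cong (d *_) (∣p∣≡sum W) ⟩
          d * ∑[ y < n ] ⟦ y ∈? W ⟧                             ≡⟨ *-distribˡ-sum d (λ y → ⟦ y ∈? W ⟧) ⟩
          ∑[ y < n ] (d * ⟦ y ∈? W ⟧)                           ≡⟨ sum-cong-≗ (λ y → *-comm d ⟦ y ∈? W ⟧) ⟩
          ∑[ y < n ] (⟦ y ∈? W ⟧ * d)                           <⟨ sum-mono-< in-W u at-u ⟩
          ∑[ y < n ] (⟦ y ∈? W ⟧ * outdegree b y)               ≡⟨ sum-cong-≗ (λ y → *-distribˡ-sum ⟦ y ∈? W ⟧ (λ e → ⟦ tl b e ≟ᶠ y ⟧)) ⟩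
          ∑[ y < n ] ∑[ e < m ] (⟦ y ∈? W ⟧ * ⟦ tl b e ≟ᶠ y ⟧)  ≡⟨ ∑-comm (λ y e → ⟦ y ∈? W ⟧ * ⟦ tl b e ≟ᶠ y ⟧) ⟩
          ∑[ e < m ] ∑[ y < n ] (⟦ y ∈? W ⟧ * ⟦ tl b e ≟ᶠ y ⟧)  ≡⟨ sum-cong-≗ (λ e → sum-cong-≗ λ y → *-comm ⟦ y ∈? W ⟧ ⟦ tl b e ≟ᶠ y ⟧) ⟩
          ∑[ e < m ] ∑[ y < n ] (⟦ tl b e ≟ᶠ y ⟧ * ⟦ y ∈? W ⟧)  ≡⟨ sum-cong-≗ (λ e → sum-pick (tl b e) (λ y → ⟦ y ∈? W ⟧)) ⟩
          ∑[ e < m ] ⟦ tl b e ∈? W ⟧                            ≤⟨ sum-mono-≤ (λ e → ⟦⟧-mono (tl b e ∈? W) (within? e) (within e)) ⟩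
          edgesWithin W                                         ∎

  -- Hakimi's theorem, inserting the edges one at a time.
  orient : ∀ d (ends : Fin m → Fin n × Fin n) →
           (∀ W → Nonempty W → edgesWithin ends W ≤ d * ∣ W ∣) → ∃ (Bounded ends d)
  orient {zero}  d ends sparse = (λ ()) , λ _ → z≤n
  orient {suc m} d ends sparse with orient d (ends ∘ suc) (λ W W≢∅ → ≤-trans (m≤n+m _ _) (sparse W W≢∅))
  ... | b , b-bounded = insert (outdegree ends b⁺ u ≤? d)
    where
    -- The new edge raises the outdegree of `u` alone, and by one. So at most one vertex exceeds
    -- `d`, as `augment` requires.
    b⁺ : Orientation (suc m)
    b⁺ = true F.∷ b

    u = proj₁ (ends zero)

    rest : ∀ y → y ≢ u → outdegree ends b⁺ y ≤ d
    rest y y≢u rewrite ⟦⟧-no (u ≟ᶠ y) (≢-sym y≢u) = b-bounded y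

    insert : Dec (outdegree ends b⁺ u ≤ d) → ∃ (Bounded ends d)
    insert (yes u≤d) = b⁺ , bounded ends d b⁺ u rest u≤d
    insert (no  u≰d) with excess⇒reach ends d sparse b⁺ u (≰⇒> u≰d)
    ... | k , r = augment ends d k b⁺ u rest (+-mono-≤ (⟦⟧-≤1 (u ≟ᶠ u)) (b-bounded u)) r

  -- Clearing denominators in rational inequalities.

  toℚᵘ-/ : ∀ a d → ℚ.toℚᵘ ((+ a) ℚ./ suc d) ℚᵘ.≃ ℚᵘ.mkℚᵘ (+ a) d
  toℚᵘ-/ a d = ℚ.toℚᵘ-fromℚᵘ (ℚᵘ.mkℚᵘ (+ a) d)

  /-≤⇒*-≤ : ∀ a b c d .{{_ : NonZero c}} .{{_ : NonZero d}} →
            (+ a) ℚ./ c ℚ.≤ (+ b) ℚ./ d → a * d ≤ b * c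
  /-≤⇒*-≤ a b (suc c) (suc d) a/c≤b/d = ℤ.drop‿+≤+
    (subst₂ ℤ._≤_ (sym (ℤ.pos-* a (suc d))) (sym (ℤ.pos-* b (suc c)))
      (ℚᵘ.drop-*≤* (ℚᵘ.≤-respʳ-≃ (toℚᵘ-/ b d) (ℚᵘ.≤-respˡ-≃ (toℚᵘ-/ a c) (ℚ.toℚᵘ-mono-≤ a/c≤b/d)))))

  -- A quarter of the average degree `2E/w` is `E/(2w)`. The hypothesis has the shape in which
  -- `length-edges-≤` counts codes.
  quarter-≤ : ∀ E w ℓ .{{_ : NonZero w}} → E ≤ w * (ℓ * 2) →
              ((+ (2 * E)) ℚ./ w) ℚ.÷ (+ 4 ℚ./ 1) ℚ.≤ (+ ℓ) ℚ./ 1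
  quarter-≤ E (suc w) ℓ E≤ = ℚ.toℚᵘ-cancel-≤
    (ℚᵘ.≤-respˡ-≃ (ℚᵘ.≃-sym (ℚᵘ.≃-trans
        (ℚ.toℚᵘ-homo-* ((+ (2 * E)) ℚ./ suc w) (ℚ.1/ (+ 4 ℚ./ 1)))
        (ℚᵘ.*-congʳ {ℚ.toℚᵘ (ℚ.1/ (+ 4 ℚ./ 1))} (toℚᵘ-/ (2 * E) w))))
    (ℚᵘ.≤-respʳ-≃ (ℚᵘ.≃-sym (toℚᵘ-/ ℓ 0)) (ℚᵘ.*≤* (subst₂ ℤ._≤_
      (trans (ℤ.pos-* (2 * E * 1) 1) (cong (ℤ._* + 1) (ℤ.pos-* (2 * E) 1)))
      (ℤ.pos-* ℓ (suc w * 4))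
      (ℤ.+≤+ (subst₂ _≤_ (lhs E) (rhs (suc w) ℓ) (*-monoʳ-≤ 2 E≤)))))))
    where
    -- The factors 1 are the numerator of 1/4 and the denominator of `ℓ/1`, left by unnormalised
    -- arithmetic.
    lhs : ∀ E → 2 * E ≡ 2 * E * 1 * 1
    lhs = solve-∀
    rhs : ∀ w ℓ → 2 * (w * (ℓ * 2)) ≡ ℓ * (w * 4)
    rhs = solve-∀

  -- Half of the average degree `2E/w` is `E/w`; the hypothesis is the conclusion multiplied by `w`.
  ≤-half+2 : ∀ E w k .{{_ : NonZero w}} → k * w ≤ E + 2 * w →
             (+ k) ℚ./ 1 ℚ.≤ (((+ (2 * E)) ℚ./ w) ℚ.÷ (+ 2 ℚ./ 1)) ℚ.+ (+ 2 ℚ./ 1)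
  ≤-half+2 E (suc w) k k≤ = ℚ.toℚᵘ-cancel-≤
    (ℚᵘ.≤-respʳ-≃ (ℚᵘ.≃-sym (ℚᵘ.≃-trans
        (ℚ.toℚᵘ-homo-+ (((+ (2 * E)) ℚ./ suc w) ℚ.÷ (+ 2 ℚ./ 1)) (+ 2 ℚ./ 1))
        (ℚᵘ.+-congˡ (ℚ.toℚᵘ (+ 2 ℚ./ 1)) (ℚᵘ.≃-trans
          (ℚ.toℚᵘ-homo-* ((+ (2 * E)) ℚ./ suc w) (ℚ.1/ (+ 2 ℚ./ 1)))
          (ℚᵘ.*-congʳ {ℚ.toℚᵘ (ℚ.1/ (+ 2 ℚ./ 1))} (toℚᵘ-/ (2 * E) w))))))
    (ℚᵘ.≤-respˡ-≃ (ℚᵘ.≃-sym (toℚᵘ-/ k 0)) (ℚᵘ.*≤* (subst₂ ℤ._≤_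
      (ℤ.pos-* k (suc w * 2 * 1))
      (trans (ℤ.pos-* (2 * E * 1 * 1 + 2 * (suc w * 2)) 1) (cong (ℤ._* + 1)
        (trans (ℤ.pos-+ (2 * E * 1 * 1) (2 * (suc w * 2))) (cong₂ ℤ._+_
          (trans (ℤ.pos-* (2 * E * 1) 1) (cong (ℤ._* + 1) (ℤ.pos-* (2 * E) 1)))
          (ℤ.pos-* 2 (suc w * 2))))))
      (ℤ.+≤+ (subst₂ _≤_ (lhs (suc w) k) (rhs E (suc w)) (*-monoʳ-≤ 2 k≤)))))))
    where
    lhs : ∀ w k → 2 * (k * w) ≡ k * (w * 2 * 1)
    lhs = solve-∀
    rhs : ∀ E w → 2 * (E + 2 * w) ≡ (2 * E * 1 * 1 + 2 * (w * 2)) * 1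
    rhs = solve-∀

  -- Numbering list entries, members of a subset and edges.

  lookup-injective : ∀ {xs : List A} → Unique xs → ∀ i j → lookup xs i ≡ lookup xs j → i ≡ j
  lookup-injective (_ ∷ _)  zero    zero    _  = refl
  lookup-injective (x≢ ∷ _) zero    (suc j) eq = contradiction eq (All.lookup x≢ (∈-lookup j))
  lookup-injective (x≢ ∷ _) (suc i) zero    eq = contradiction (sym eq) (All.lookup x≢ (∈-lookup i))
  lookup-injective (_ ∷ u)  (suc i) (suc j) eq = cong suc (lookup-injective u i j eq)

  rank : ∀ {W : Subset n} {x} → x ∈ˢ W → Fin ∣ W ∣
  rank here                        = zero
  rank {W = inside  ∷ _} (there p) = suc (rank p)
  rank {W = outside ∷ _} (there p) = rank p

  rank-injective : ∀ {W : Subset n} {x y} (p : x ∈ˢ W) (q : y ∈ˢ W) → rank p ≡ rank q → x ≡ y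
  rank-injective here      here      _  = refl
  rank-injective {W = inside  ∷ _} (there p) (there q) eq = cong suc (rank-injective p q (Fin.suc-injective eq))
  rank-injective {W = outside ∷ _} (there p) (there q) eq = cong suc (rank-injective p q eq)

  module _ (G : Graph n) where
    open Graph G

    edge⇒∈ : ∀ {u v} → u <ᶠ v → u ~ v → (u , v) ∈ edges
    edge⇒∈ u<v u~v = ∈-filter⁺ (λ (u , v) → (u <ᶠ? v) ×-dec (u ~? v))
      (∈-cartesianProduct⁺ (∈-allFin _) (∈-allFin _)) (u<v , u~v)

    ∈⇒edge : ∀ {u v} → (u , v) ∈ edges → u <ᶠ v × u ~ v
    ∈⇒edge p = proj₂ (∈-filter⁻ (λ (u , v) → (u <ᶠ? v) ×-dec (u ~? v))
      {xs = cartesianProduct (allFin n) (allFin n)} p)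

    edges-unique : Unique edges
    edges-unique = Unique.filter⁺ _ (Unique.cartesianProduct⁺ (Unique.allFin⁺ n) (Unique.allFin⁺ n))

  -- Lower bound: charging edges to pairs of a vertex and a queue.

  module _ {G : Graph n} (L : QueueLayout G) where
    open Graph G
    open QueueLayout L
    open IsStrictTotalOrder isStrictTotalOrder using (compare) renaming (_<?_ to _≺?_)

    -- If l w is an edge of q with r ≺ w, then no edge of q joins r to a vertex
    -- between l and r, as it would nest with l w. So in the second case l is
    -- determined by r and q.
    data Charge (l r : Fin n) : Fin n → Fin #queues → Fin 2 → Set where
      last    : ∀ {q} → queue l r ≡ q → (∀ w → l ~ w → queue l w ≡ q → ¬ r ≺ w) → Charge l r l q zero
      notLast : ∀ {q} → queue l r ≡ q → ∀ w → l ~ w → queue l w ≡ q → r ≺ w → Charge l r r q (suc zero)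

    -- For `last` the left end is shared, and the farther of two right ends would refute the
    -- maximality of the other. For `notLast` the right end is shared, and the longer edge from the
    -- leftmost left end would enclose the other edge. The tag in `Fin 2` excludes mixed pairs.
    charge-injective : ∀ {l r l′ r′ x q s} → l ~ r → l′ ~ r′ → l ≺ r → l′ ≺ r′ →
                       Charge l r x q s → Charge l′ r′ x q s → l ≡ l′ × r ≡ r′
    charge-injective {r = r} {r′ = r′} l~r l~r′ _ _ (last q max) (last q′ max′) with compare r r′
    ... | tri< r≺r′ _ _ = contradiction r≺r′ (max r′ l~r′ q′)
    ... | tri≈ _ eq _   = refl , eq
    ... | tri> _ _ r′≺r = contradiction r′≺r (max′ r l~r q)
    charge-injective {l = l} {r} {l′} l~r l′~r l≺r l′≺r (notLast q w l~w qw r≺w) (notLast q′ w′ l′~w′ qw′ r≺w′)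
      with compare l l′
    ... | tri< l≺l′ _ _ = contradiction (inj₁ (l≺l′ , l′≺r , r≺w))
                            (noNest l w l′ r l~w l′~r (trans qw (sym q′)))
    ... | tri≈ _ eq _   = eq , refl
    ... | tri> _ _ l′≺l = contradiction (inj₁ (l′≺l , l≺r , r≺w′))
                            (noNest l′ w′ l r l′~w′ l~r (trans qw′ (sym q)))

    ∈-queuesAt : ∀ {u v q} → u ~ v → queue u v ≡ q → q ∈ queuesAt G queue u
    ∈-queuesAt u~v eq = ∈-filter⁺ _ (∈-allFin _) (_ , u~v , eq)

    module _ (H : Subgraph G) where
      private module H = Subgraph H

      -- Listed edges are sorted by `<ᶠ`, but charging sorts the ends by `≺`; `same` ties the two
      -- descriptions together.
      record Charged (u v : Fin n) : Set where
        field
          {l r x} : Fin n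
          {q}     : Fin #queues
          {s}     : Fin 2
          l~r     : l ~ r
          l≺r     : l ≺ r
          charge  : Charge l r x q s
          x∈      : x ∈ˢ H.vertices
          q∈      : q ∈ queuesAt G queue x
          same    : (u ≡ l × v ≡ r) ⊎ (u ≡ r × v ≡ l)

      charge-≺ : ∀ {u v l r} → l H.~ r → l ≺ r → (u ≡ l × v ≡ r) ⊎ (u ≡ r × v ≡ l) → Charged u v
      -- The search runs over edges of `G`, where the queue is free of nesting; only the charged end
      -- has to lie in `H`.
      charge-≺ {l = l} {r} e l≺r same with any? (λ w → (l ~? w) ×-dec (queue l w ≟ᶠ queue l r) ×-dec (r ≺? w))
      ... | yes (w , l~w , qw , r≺w) = record
        { l~r = H.edge⊆ e ; l≺r = l≺r ; charge = notLast refl w l~w qw r≺w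
        ; x∈ = H.endpoint∈ (H.~-sym e) ; q∈ = ∈-queuesAt (H.edge⊆ (H.~-sym e)) (queue-sym r l) ; same = same }
      ... | no ¬w = record
        { l~r = H.edge⊆ e ; l≺r = l≺r ; charge = last refl (λ w l~w qw r≺w → ¬w (w , l~w , qw , r≺w))
        ; x∈ = H.endpoint∈ e ; q∈ = ∈-queuesAt (H.edge⊆ e) refl ; same = same }

      charged : ∀ {u v} → u H.~ v → Charged u v
      charged {u} {v} e with compare u v
      ... | tri< u≺v _ _ = charge-≺ e u≺v (inj₁ (refl , refl))
      ... | tri≈ _ u≡v _ = contradiction e (H.~-irrefl u≡v)
      ... | tri> _ _ v≺u = charge-≺ (H.~-sym e) v≺u (inj₂ (refl , refl))

      module _ {ℓ : ℕ} (local : IsLocal G ℓ L) where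
        -- Locality enters here: the queue is recorded by its index among the at most `ℓ` queues at
        -- `x`, so the total number of queues does not affect the bound.
        code : ∀ {x q} → x ∈ˢ H.vertices → q ∈ queuesAt G queue x → Fin 2 → Fin (∣ H.vertices ∣ * (ℓ * 2))
        code {x} x∈ q∈ s = combine (rank x∈) (combine (inject≤ (index q∈) (local x)) s)

        code-injective : ∀ {x q s x′ q′ s′} (x∈ : x ∈ˢ H.vertices) (q∈ : q ∈ queuesAt G queue x)
                         (x′∈ : x′ ∈ˢ H.vertices) (q′∈ : q′ ∈ queuesAt G queue x′) →
                         code x∈ q∈ s ≡ code x′∈ q′∈ s′ → x ≡ x′ × q ≡ q′ × s ≡ s′
        code-injective {x} {s = s} {x′} {s′ = s′} x∈ q∈ x′∈ q′∈ eq
          with combine-injective (rank x∈) _ (rank x′∈) _ eq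
        ... | rank≡ , eq′
          with rank-injective x∈ x′∈ rank≡
             | combine-injective (inject≤ (index q∈) (local x)) s (inject≤ (index q′∈) (local x′)) s′ eq′
        -- Queue indices are relative to the vertex, so the vertices are identified before the
        -- indices are compared.
        ... | refl | inject≡ , s≡ =
          refl , index-injective (setoid _) q∈ q′∈ (inject≤-injective (local x) (local x) _ _ inject≡) , s≡

        charged-injective : ∀ {u v u′ v′} → u <ᶠ v → u′ <ᶠ v′ → (c : Charged u v) (c′ : Charged u′ v′) →
                            code (Charged.x∈ c) (Charged.q∈ c) (Charged.s c) ≡
                            code (Charged.x∈ c′) (Charged.q∈ c′) (Charged.s c′) →
                            (u , v) ≡ (u′ , v′)
        charged-injective u<v u′<v′ c c′ eq
          with code-injective (Charged.x∈ c) (Charged.q∈ c) (Charged.x∈ c′) (Charged.q∈ c′) eq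
        ... | x≡ , q≡ , s≡
          with charge-injective (Charged.l~r c) (Charged.l~r c′) (Charged.l≺r c) (Charged.l≺r c′)
                 (Charged.charge c)
                 (subst₂ (λ x (q , s) → Charge (Charged.l c′) (Charged.r c′) x q s)
                         (sym x≡) (sym (cong₂ _,_ q≡ s≡)) (Charged.charge c′))
             | Charged.same c | Charged.same c′
        ... | refl , refl | inj₁ (refl , refl) | inj₁ (refl , refl) = refl
        ... | refl , refl | inj₂ (refl , refl) | inj₂ (refl , refl) = refl
        -- Opposite matchings would list one edge in both orders, against `u <ᶠ v` and `u′ <ᶠ v′`.
        ... | refl , refl | inj₁ (refl , refl) | inj₂ (refl , refl) = contradiction u′<v′ (Fin.<-asym u<v)
        ... | refl , refl | inj₂ (refl , refl) | inj₁ (refl , refl) = contradiction u′<v′ (Fin.<-asym u<v)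

        length-edges-≤ : length H.edges ≤ ∣ H.vertices ∣ * (ℓ * 2)
        length-edges-≤ = injective⇒≤
          {f = λ i → code (Charged.x∈ (at i)) (Charged.q∈ (at i)) (Charged.s (at i))} λ {i} {j} eq →
          lookup-injective (edges-unique H.edgeGraph) i j
            (charged-injective (proj₁ (edge i)) (proj₁ (edge j)) (at i) (at j) eq)
          where
          edge : ∀ i → _
          edge i = ∈⇒edge H.edgeGraph (∈-lookup {xs = H.edges} i)

          at : ∀ i → Charged _ _
          at i = charged (proj₂ (edge i))

  -- Upper bound: the layout by stars of an orientation.

  module _ (G : Graph n) where
    open Graph G

    module StarLayout (b : Orientation (length edges)) where
      open Min (Fin.≤-totalOrder n) using (_⊓_; ⊓-comm; x≤y⇒x⊓y≈x)
      open Max (Fin.≤-totalOrder n) using (_⊔_; ⊔-comm; x≤y⇒x⊔y≈y)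

      tail head : Fin (length edges) → Fin n
      tail = tl (lookup edges) b
      head = hd (lookup edges) b

      listed? : ∀ u v → Dec (∃ λ e → lookup edges e ≡ (u , v))
      listed? u v = any? (λ e → ≡-dec _≟ᶠ_ _≟ᶠ_ (lookup edges e) (u , v))

      -- Off the edge list the value is arbitrary.
      centre : ∀ u v → Dec (∃ λ e → lookup edges e ≡ (u , v)) → Fin n
      centre _ _ (yes (e , _)) = head e
      centre u _ (no _)        = u

      -- Sorting the ends first matches the way edges are listed and reduces symmetry to
      -- commutativity of minimum and maximum.
      queue : Fin n → Fin n → Fin n
      queue u v = centre (u ⊓ v) (u ⊔ v) (listed? (u ⊓ v) (u ⊔ v))

      queue-sym : ∀ u v → queue u v ≡ queue v u
      queue-sym u v = cong₂ (λ x y → centre x y (listed? x y)) (⊓-comm u v) (⊔-comm u v)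

      Arc : Fin n → Fin n → Fin n → Set
      Arc q u v = ∃ λ e → head e ≡ q × ((tail e ≡ u × q ≡ v) ⊎ (tail e ≡ v × q ≡ u))

      arc-< : ∀ {u v} → u <ᶠ v → u ~ v → Arc (queue u v) u v
      arc-< {u} {v} u<v u~v
        rewrite x≤y⇒x⊓y≈x (<⇒≤ u<v) | x≤y⇒x⊔y≈y (<⇒≤ u<v) with listed? u v
      ... | no ¬e = contradiction (index u,v∈ , sym (lookup-index u,v∈)) ¬e
        where u,v∈ = edge⇒∈ G u<v u~v
      ... | yes (e , eq) = e , refl , ends
        where
        ends : (tail e ≡ u × head e ≡ v) ⊎ (tail e ≡ v × head e ≡ u)
        ends with b e
        ... | true  = inj₁ (cong proj₁ eq , cong proj₂ eq)
        ... | false = inj₂ (cong proj₂ eq , cong proj₁ eq)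

      queue-arc : ∀ {u v} → u ~ v → Arc (queue u v) u v
      queue-arc {u} {v} u~v with Fin.<-cmp u v
      ... | tri< u<v _ _ = arc-< u<v u~v
      ... | tri≈ _ u≡v _ = contradiction u~v (~-irrefl u≡v)
      ... | tri> _ _ v<u with arc-< v<u (~-sym u~v)
      ...   | e , head≡ , ends = e , trans head≡ (queue-sym v u) ,
        Sum.swap (subst (λ q → (tail e ≡ v × q ≡ u) ⊎ (tail e ≡ u × q ≡ v)) (queue-sym v u) ends)

      queue-end : ∀ {u v} → u ~ v → queue u v ≡ u ⊎ queue u v ≡ v
      queue-end u~v with queue-arc u~v
      ... | _ , _ , inj₁ (_ , q≡) = inj₂ q≡
      ... | _ , _ , inj₂ (_ , q≡) = inj₁ q≡

      -- Edges of one queue share its centre as an end, whereas strict nesting makes the ends of one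
      -- edge differ from those of the other.
      between : ∀ {u v x y} → u ~ v → x ~ y → queue u v ≡ queue x y → ¬ (u <ᶠ x × x <ᶠ y × y <ᶠ v)
      between u~v x~y eq (u<x , x<y , y<v) with queue-end u~v | queue-end x~y
      ... | inj₁ p | inj₁ q = Fin.<⇒≢ u<x (trans (sym p) (trans eq q))
      ... | inj₁ p | inj₂ q = Fin.<⇒≢ (Fin.<-trans u<x x<y) (trans (sym p) (trans eq q))
      ... | inj₂ p | inj₁ q = Fin.<⇒≢ (Fin.<-trans x<y y<v) (trans (sym q) (trans (sym eq) p))
      ... | inj₂ p | inj₂ q = Fin.<⇒≢ y<v (trans (sym q) (trans (sym eq) p))

      layout : QueueLayout G
      layout = record
        { _≺_                = _<ᶠ_
        ; isStrictTotalOrder = Fin.<-isStrictTotalOrder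
        ; #queues            = n
        ; queue              = queue
        ; queue-sym          = queue-sym
        ; noNest             = λ where
            u v x y u~v x~y eq (inj₁ nest) → between u~v x~y eq nest
            u v x y u~v x~y eq (inj₂ nest) → between x~y u~v (sym eq) nest
        }

      length-queuesAt-≤ : ∀ v → length (queuesAt G queue v) ≤ suc (outdegree (lookup edges) b v)
      length-queuesAt-≤ v = begin
        length (queuesAt G queue v)                          ≡⟨ length-filter-tabulate at? id ⟩
        ∑[ i < n ] ⟦ at? i ⟧                                 ≤⟨ sum-mono-≤ star ⟩
        ∑[ i < n ] (⟦ v ≟ᶠ i ⟧ * 1 + ∑[ e < m′ ] arcs i e)    ≡⟨ ∑-distrib-+ (λ i → ⟦ v ≟ᶠ i ⟧ * 1) (λ i → ∑[ e < m′ ] arcs i e) ⟩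
        ∑[ i < n ] (⟦ v ≟ᶠ i ⟧ * 1) + ∑[ i < n ] ∑[ e < m′ ] arcs i e
                                                             ≡⟨ cong₂ _+_ (sum-pick v (λ _ → 1)) (∑-comm arcs) ⟩
        1 + ∑[ e < m′ ] ∑[ i < n ] arcs i e                   ≡⟨ cong suc (sum-cong-≗ λ e → sum-pick (head e) (λ _ → ⟦ tail e ≟ᶠ v ⟧)) ⟩
        suc (outdegree (lookup edges) b v)                   ∎
        where
        open ≤-Reasoning

        m′ = length edges

        at? : ∀ i → Dec (∃ λ w → v ~ w × queue v w ≡ i)
        at? i = any? (λ w → (v ~? w) ×-dec (queue v w ≟ᶠ i))

        arcs : Fin n → Fin m′ → ℕ
        arcs i e = ⟦ head e ≟ᶠ i ⟧ * ⟦ tail e ≟ᶠ v ⟧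

        -- A queue `i` present at `v` is paid for by the first term if `v` is its centre, and
        -- otherwise by an arc from `v` to `i`. The factor 1 fits the form of `sum-pick`.
        star : ∀ i → ⟦ at? i ⟧ ≤ ⟦ v ≟ᶠ i ⟧ * 1 + ∑[ e < m′ ] arcs i e
        star i with at? i
        ... | no _ = z≤n
        ... | yes (w , v~w , refl) with queue-arc v~w
        ...   | e , head≡ , inj₁ (tail≡ , _) = ≤-trans
          (≤-reflexive (sym (cong₂ _*_ (⟦⟧-yes (head e ≟ᶠ i) head≡) (⟦⟧-yes (tail e ≟ᶠ v) tail≡))))
          (≤-trans (term≤sum (arcs i) e) (m≤n+m _ _))
        ...   | e , _ , inj₂ (_ , q≡v) = ≤-trans
          (≤-reflexive (sym (cong (_* 1) (⟦⟧-yes (v ≟ᶠ i) (sym q≡v))))) (m≤m+n _ _)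

    induced : (W : Subset n) → Nonempty W → Subgraph G
    induced W W≢∅ = record
      { vertices  = W
      ; nonempty  = W≢∅
      ; edgeGraph = record
        { _~_      = λ u v → u ~ v × u ∈ˢ W × v ∈ˢ W
        ; ~-sym    = λ (e , u∈ , v∈) → ~-sym e , v∈ , u∈
        ; ~-irrefl = λ eq (e , _) → ~-irrefl eq e
        ; _~?_     = λ u v → (u ~? v) ×-dec (u ∈? W) ×-dec (v ∈? W)
        }
      ; edge⊆     = proj₁
      ; endpoint∈ = proj₁ ∘ proj₂
      }

  -- Edges inside a vertex set and induced subgraphs.

  length-filter-filter : ∀ {P Q R : A → Set} (P? : U.Decidable P) (Q? : U.Decidable Q) (R? : U.Decidable R) →
                         (∀ {x} → P x → Q x → R x) →
                         ∀ xs → length (filter P? (filter Q? xs)) ≤ length (filter R? xs)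
  length-filter-filter P? Q? R? f [] = z≤n
  length-filter-filter P? Q? R? f (x ∷ xs) with Q? x | R? x
  ... | no _  | no _  = length-filter-filter P? Q? R? f xs
  ... | no _  | yes _ = m≤n⇒m≤1+n (length-filter-filter P? Q? R? f xs)
  ... | yes q | r with P? x
  ...   | no _  with r
  ...     | no _  = length-filter-filter P? Q? R? f xs
  ...     | yes _ = m≤n⇒m≤1+n (length-filter-filter P? Q? R? f xs)
  length-filter-filter P? Q? R? f (x ∷ xs) | yes q | r | yes p with r
  ...     | yes _ = s≤s (length-filter-filter P? Q? R? f xs)
  ...     | no ¬r = contradiction (f p q) ¬r

  module _ (G : Graph n) where
    open Graph G

    edgesWithin≡ : ∀ W → edgesWithin (lookup edges) W ≡
                         length (filter (λ (u , v) → (u ∈? W) ×-dec (v ∈? W)) edges)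
    edgesWithin≡ W = trans (sym (length-filter-tabulate within? (lookup edges)))
      (cong (length ∘ filter within?) (tabulate-lookup edges))
      where
      within? : U.Decidable (λ ((u , v) : Fin n × Fin n) → u ∈ˢ W × v ∈ˢ W)
      within? (u , v) = (u ∈? W) ×-dec (v ∈? W)

    -- Both counts come from filtering the same list of all pairs, so they can be compared entry by
    -- entry.
    edgesWithin≤edges-induced : ∀ W (W≢∅ : Nonempty W) → edgesWithin (lookup edges) W ≤
                                length (Subgraph.edges (induced G W W≢∅))
    edgesWithin≤edges-induced W W≢∅ = ≤-trans (≤-reflexive (edgesWithin≡ W))
      (length-filter-filter _ _ _ (λ (u∈ , v∈) (u<v , u~v) → u<v , u~v , u∈ , v∈)
                            (cartesianProduct (allFin n) (allFin n)))

    localLayout : ∀ d → (∀ W → Nonempty W → edgesWithin (lookup edges) W ≤ d * ∣ W ∣) →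
                  HasLocalQueueLayout G (suc d)
    localLayout d sparse with orient d (lookup edges) sparse
    ... | b , b-bounded = layout , λ v → ≤-trans (length-queuesAt-≤ v) (s≤s (b-bounded v))
      where open StarLayout G b

  -- The two bounds in terms of the maximum average degree.

  module _ {G : Graph n} where
    -- The edge count is applied to a subgraph `H` that attains the maximum.
    quarter-mad-≤ : ∀ {q ℓ} → IsMaximumAverageDegree G q → HasLocalQueueLayout G ℓ →
                    q ℚ.÷ (+ 4 ℚ./ 1) ℚ.≤ (+ ℓ) ℚ./ 1
    quarter-mad-≤ {ℓ = ℓ} ((H , refl) , _) (L , local) =
      quarter-≤ (length (Subgraph.edges H)) ∣ Subgraph.vertices H ∣ ℓ
        {{nonempty⇒nonZero (Subgraph.nonempty H)}} (length-edges-≤ L H local)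

    -- By maximality the subgraph induced on `W` satisfies `2E′/w′ ≤ 2E/w ≤ 2d`. Clearing
    -- denominators and cancelling `2` and `w` gives the claim.
    edgesWithin-≤ : ∀ (H : Subgraph G) → (∀ K → averageDegree K ℚ.≤ averageDegree H) →
                    ∀ d → length (Subgraph.edges H) ≤ d * ∣ Subgraph.vertices H ∣ →
                    ∀ W → Nonempty W → edgesWithin (lookup (Graph.edges G)) W ≤ d * ∣ W ∣
    edgesWithin-≤ H maximal d E≤d*w W W≢∅ = ≤-trans (edgesWithin≤edges-induced G W W≢∅)
      (*-cancelʳ-≤ E′ (d * w′) w (*-cancelˡ-≤ 2 (begin
        2 * (E′ * w)      ≡⟨ *-assoc 2 E′ w ⟨
        2 * E′ * w        ≤⟨ /-≤⇒*-≤ (2 * E′) (2 * E) w′ w (maximal (induced G W W≢∅)) ⟩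
        2 * E * w′        ≤⟨ *-monoˡ-≤ w′ (*-monoʳ-≤ 2 E≤d*w) ⟩
        2 * (d * w) * w′  ≡⟨ lemma d w w′ ⟩
        2 * (d * w′ * w)  ∎)))
      where
      open ≤-Reasoning

      E w E′ w′ : ℕ
      E  = length (Subgraph.edges H)
      w  = ∣ Subgraph.vertices H ∣
      E′ = length (Subgraph.edges (induced G W W≢∅))
      w′ = ∣ W ∣

      instance
        w≢0 : NonZero w
        w≢0 = nonempty⇒nonZero (Subgraph.nonempty H)

        w′≢0 : NonZero w′
        w′≢0 = nonempty⇒nonZero W≢∅

      lemma : ∀ d w w′ → 2 * (d * w) * w′ ≡ 2 * (d * w′ * w)
      lemma = solve-∀

    ≤-half-mad+2 : ∀ {q ℓ} → IsMaximumAverageDegree G q → (∀ k → HasLocalQueueLayout G k → ℓ ≤ k) →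
                   (+ ℓ) ℚ./ 1 ℚ.≤ (q ℚ.÷ (+ 2 ℚ./ 1)) ℚ.+ (+ 2 ℚ./ 1)
    ≤-half-mad+2 {ℓ = ℓ} ((H , refl) , maximal) minimal = ≤-half+2 E w ℓ (begin
      ℓ * w               ≤⟨ *-monoˡ-≤ w (minimal (suc d) (localLayout G d (edgesWithin-≤ H maximal d E≤d*w))) ⟩
      suc d * w           ≡⟨ lemma (E / w) w ⟩
      E / w * w + 2 * w  ≤⟨ +-monoˡ-≤ (2 * w) (m/n*n≤m E w) ⟩
      E + 2 * w           ∎)
      where
      open ≤-Reasoning

      E w : ℕ
      E = length (Subgraph.edges H)
      w = ∣ Subgraph.vertices H ∣

      instance
        w≢0 : NonZero w
        w≢0 = nonempty⇒nonZero (Subgraph.nonempty H)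

      -- `E / w` is half the maximum average degree, rounded down; one more ensures `E ≤ d * w`. The
      -- star centred at each vertex adds another one, which together make the 2 in the bound.
      d : ℕ
      d = suc (E / w)

      E≤d*w : E ≤ d * w
      E≤d*w = ≤-trans (≤-reflexive (m≡m%n+[m/n]*n E w)) (+-monoˡ-≤ _ (<⇒≤ (m%n<n E w)))

      lemma : ∀ q w → (2 + q) * w ≡ q * w + 2 * w
      lemma = solve-∀

open LocalQueueLayouts using (quarter-mad-≤; ≤-half-mad+2)
open import Data.Rational.Base using (_≤_; _+_; _÷_; _/_)

theorem2 : ∀ {n : ℕ} .{{_ : NonZero n}} (G : Graph n) →
    (mad G ÷ (+ 4 / 1) ≤ (+ qnℓ G) / 1) ×
    ((+ qnℓ G) / 1 ≤ (mad G ÷ (+ 2 / 1)) + (+ 2 / 1))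
theorem2 G =
  quarter-mad-≤ (mad-isMaximumAverageDegree G) (proj₁ (qnℓ-isLocalQueueNumber G)) ,
  ≤-half-mad+2 (mad-isMaximumAverageDegree G) (proj₂ (qnℓ-isLocalQueueNumber G))
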